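{- Let $P$ be a countable meet-continuous dcpo with binary meets. For each nonprincipal ideal $J$ of $P$, there exist $s<t\le\bigvee J$ in $P$ such that $[s,t)$ is directed and \[ \mathord{\downarrow}[s,t)\subseteq J,\qquad \bigvee[s,t)=t\notin J. \]
   Context: All posets and directed sets are nonempty; countable sets may be finite. A subset $D$ of a poset is directed if any two of its elements have a common upper bound in $D$. A dcpo is a poset in which every directed subset has a supremum. Write $\mathord{\downarrow}x=\{y:y\le x\}$ and $\mathord{\downarrow}A=\bigcup_{a\in A}\mathord{\downarrow}a$. An ideal is a directed lower set; it is principal if it has the form $\mathord{\downarrow}x$. For $s<t$, $[s,t)=\{x:s\le x<t\}$. An upper set $U\subseteq P$ is Scott open if for every directed $D\subseteq P$, $\bigvee D\in U$ implies $D\cap U\neq\emptyset$; the Scott open sets form the Scott topology $\sigma(P)$. A dcpo $P$ is meet-continuous if for every $x\in P$ and every directed $D\subseteq P$, $x\le\bigvee D$ implies $x\in\operatorname{cl}_{\sigma(P)}(\mathord{\downarrow}x\cap\mathord{\downarrow}D)$, where $\operatorname{cl}_{\sigma(P)}$ is closure in the Scott topology. "With binary meets" means any two elements of $P$ have a greatest lower bound in $P$. -}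

module Defs where

open import Data.Nat.Base using (ℕ)
open import Data.Product.Base using (_×_; ∃)
open import Function.Bundles using (Injection)
open import Level using (Level; suc)
open import Relation.Binary.Bundles using (Poset)
open import Relation.Binary.Lattice.Definitions using (Infimum)
open import Relation.Binary.PropositionalEquality.Properties using (setoid)
open import Relation.Unary using (Pred; _∈_; _⊆_; _≐_; _∩_; _≬_; ∁; Satisfiable)
import Relation.Binary.Properties.Poset as PosetProperties

-- The carrier, the order and the subsets all live at one level ℓ, so that
-- ↓ x, ⇓ A and [ s , t ⟩ are again subsets in the sense of `Pred Carrier ℓ`.
module DomainTheory {ℓ : Level} (P : Poset ℓ ℓ ℓ) where

  open Poset P using (Carrier; _≤_; module Eq)
  open PosetProperties P using (_<_) public

  -- Possibly finite: an injection into ℕ, with respect to the equality _≈_.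
  Countable : Set ℓ
  Countable = Injection Eq.setoid (setoid ℕ)

  HasBinaryMeets : Set ℓ
  HasBinaryMeets = ∃ λ _∧_ → Infimum _≤_ _∧_

  ↓_ : Carrier → Pred Carrier ℓ
  (↓ x) y = y ≤ x

  ⇓_ : Pred Carrier ℓ → Pred Carrier ℓ
  (⇓ A) y = ∃ λ a → a ∈ A × y ∈ (↓ a)

  [_,_⟩ : Carrier → Carrier → Pred Carrier ℓ
  [ s , t ⟩ x = s ≤ x × x < t

  IsLowerSet : Pred Carrier ℓ → Set ℓ
  IsLowerSet A = ∀ {x y} → y ≤ x → x ∈ A → y ∈ A

  IsUpperSet : Pred Carrier ℓ → Set ℓ
  IsUpperSet A = ∀ {x y} → x ≤ y → x ∈ A → y ∈ A

  record IsDirected (D : Pred Carrier ℓ) : Set ℓ where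
    field
      nonempty   : Satisfiable D
      upperBound : ∀ {x y} → x ∈ D → y ∈ D →
                   ∃ λ z → z ∈ D × x ≤ z × y ≤ z

  record IsSupremum (A : Pred Carrier ℓ) (s : Carrier) : Set ℓ where
    field
      upper : ∀ {x} → x ∈ A → x ≤ s
      least : ∀ {u} → (∀ {x} → x ∈ A → x ≤ u) → s ≤ u

  record IsIdeal (J : Pred Carrier ℓ) : Set ℓ where
    field
      isDirected : IsDirected J
      isLowerSet : IsLowerSet J

  IsPrincipal : Pred Carrier ℓ → Set ℓ
  IsPrincipal J = ∃ λ x → J ≐ (↓ x)

  record IsDCPO : Set (suc ℓ) where
    field
      ⋁            : (D : Pred Carrier ℓ) → IsDirected D → Carrier
      ⋁-isSupremum : (D : Pred Carrier ℓ) (dir : IsDirected D) →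
                     IsSupremum D (⋁ D dir)

  module _ (dcpo : IsDCPO) where

    open IsDCPO dcpo

    record IsScottOpen (U : Pred Carrier ℓ) : Set (suc ℓ) where
      field
        isUpperSet   : IsUpperSet U
        inaccessible : (D : Pred Carrier ℓ) (dir : IsDirected D) →
                       ⋁ D dir ∈ U → D ≬ U

    IsScottClosed : Pred Carrier ℓ → Set (suc ℓ)
    IsScottClosed C = IsScottOpen (∁ C)

    -- The intersection of all Scott closed sets containing A.
    ScottClosure : Pred Carrier ℓ → Pred Carrier (suc ℓ)
    ScottClosure A x = (C : Pred Carrier ℓ) → IsScottClosed C → A ⊆ C → x ∈ C

    IsMeetContinuous : Set (suc ℓ)
    IsMeetContinuous =
      (x : Carrier) (D : Pred Carrier ℓ) (dir : IsDirected D) →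
      x ≤ ⋁ D dir → x ∈ ScottClosure ((↓ x) ∩ (⇓ D))

{-# OPTIONS --safe #-}

-- For t ≤ ⋁ J, meet-continuity makes t the supremum of the ideal J ∩ ↓ t.
-- So it suffices to find s ∈ J and t ∉ J with s ≤ t ≤ ⋁ J and [ s , t ⟩ ⊆ J.
-- If there were none, every interval from a point of J to a point outside J
-- could be shrunk to one of the same kind that misses any prescribed point x:
-- raise the lower end above J-points x, lower the upper end below the others.
-- Running through the countably many points of P yields nested intervals with
-- empty intersection, yet the supremum of the lower ends lies in all of them.

module Submission where

open import Defs
open import Axiom.ExcludedMiddle using (ExcludedMiddle)
open import Data.Empty using (⊥)
open import Data.Nat.Base as ℕ using (ℕ; zero; suc; _≤′_; ≤′-refl; ≤′-step)
open import Data.Nat.Properties using (≤⇒≤′; m≤m⊔n; m≤n⊔m)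
open import Data.Product.Base using (_×_; ∃; Σ; _,_; proj₁; proj₂)
open import Function.Bundles using (Injection)
open import Level as L using (Level; Lift; lift; lower)
open import Relation.Binary.Bundles using (Poset)
open import Relation.Binary.PropositionalEquality.Core using (_≡_; refl; sym; trans)
open import Relation.Nullary.Decidable using (yes; no; map′; decidable-stable)
open import Relation.Nullary.Negation.Core using (¬_; contradiction)
open import Relation.Unary using (Pred; _∈_; _⊆_; _∉_; _∩_)

lowerExcludedMiddle : {ℓ : Level} → ExcludedMiddle (L.suc ℓ) → ExcludedMiddle ℓ
lowerExcludedMiddle {ℓ} em = map′ lower lift (em {Lift (L.suc ℓ) _})

module MeetContinuity {ℓ : Level} (em : ExcludedMiddle ℓ) (P : Poset ℓ ℓ ℓ)
  (dcpo : DomainTheory.IsDCPO P) where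

  open Poset P renaming (refl to ≤-refl; trans to ≤-trans)
  open DomainTheory P
  open IsDCPO dcpo

  -- If no member of `D` escapes `↓ u`, then `u` bounds `D` and hence its supremum.
  ↓-isScottClosed : ∀ u → IsScottClosed dcpo (↓ u)
  ↓-isScottClosed u = record
    { isUpperSet   = λ x≤y x≰u y≤u → x≰u (≤-trans x≤y y≤u)
    ; inaccessible = λ D dir ⋁D≰u → decidable-stable em λ D⊆↓u →
        ⋁D≰u (IsSupremum.least (⋁-isSupremum D dir) λ x∈D →
          decidable-stable em λ x≰u → D⊆↓u (_ , x∈D , x≰u))
    }

  module _ (mc : IsMeetContinuous dcpo) {J : Pred Carrier ℓ} (ideal : IsIdeal J) where

    open IsIdeal ideal

    -- An upper bound `u` of `J ∩ (↓ t)` gives a Scott closed set `↓ u` containing `(↓ t) ∩ (⇓ J)`;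
    -- by meet-continuity it contains `t` as well.
    ∩↓-isSupremum : ∀ {t} → t ≤ ⋁ J isDirected → IsSupremum (J ∩ (↓ t)) t
    ∩↓-isSupremum {t} t≤⋁J = record
      { upper = proj₂
      ; least = λ {u} bound → mc t J isDirected t≤⋁J (↓ u) (↓-isScottClosed u)
          λ { (y≤t , _ , j∈J , y≤j) → bound (isLowerSet y≤j j∈J , y≤t) }
      }

module Ideals {ℓ : Level} (P : Poset ℓ ℓ ℓ) where

  open Poset P renaming (refl to ≤-refl; trans to ≤-trans)
  open DomainTheory P

  module _ {J : Pred Carrier ℓ} (ideal : IsIdeal J) where

    open IsIdeal ideal

    ∈∉⇒< : ∀ {x t} → x ≤ t → x ∈ J → t ∉ J → x < t
    ∈∉⇒< x≤t x∈J t∉J = x≤t , λ x≈t → t∉J (isLowerSet (reflexive (Eq.sym x≈t)) x∈J)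

    -- A bound `z` found in `J` may fail to lie below `t`; its meet with `t` does, and still
    -- dominates `x` and `y`.
    ∩↓-upperBound : HasBinaryMeets → ∀ {t x y} → x ∈ J ∩ (↓ t) → y ∈ J ∩ (↓ t) →
                    ∃ λ z → z ∈ J ∩ (↓ t) × x ≤ z × y ≤ z
    ∩↓-upperBound (_∧_ , inf) {t} (x∈J , x≤t) (y∈J , y≤t)
      with z , z∈J , x≤z , y≤z ← IsDirected.upperBound isDirected x∈J y∈J
      with t∧z≤t , t∧z≤z , greatest ← inf t z
      = t ∧ z , (isLowerSet t∧z≤z z∈J , t∧z≤t) , greatest _ x≤t x≤z , greatest _ y≤t y≤z

    module _ (meets : HasBinaryMeets) {s t : Carrier} (s∈J : s ∈ J) (s≤t : s ≤ t)
      (t∉J : t ∉ J) ([s,t⟩⊆J : [ s , t ⟩ ⊆ J) where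

      -- Only `x` is required to lie above `s`. Two points of the interval give directedness;
      -- `x = s` with arbitrary `y` shows that the interval is cofinal in `J ∩ (↓ t)`, so both have
      -- the same supremum.
      [,⟩-upperBound : ∀ {x y} → x ∈ J ∩ (↓ t) → y ∈ J ∩ (↓ t) → s ≤ x →
                       ∃ λ z → z ∈ [ s , t ⟩ × x ≤ z × y ≤ z
      [,⟩-upperBound x∈ y∈ s≤x
        with z , (z∈J , z≤t) , x≤z , y≤z ← ∩↓-upperBound meets x∈ y∈
        = z , (≤-trans s≤x x≤z , ∈∉⇒< z≤t z∈J t∉J) , x≤z , y≤z

      [,⟩-isDirected : IsDirected [ s , t ⟩
      [,⟩-isDirected = record
        { nonempty   = s , ≤-refl , ∈∉⇒< s≤t s∈J t∉J
        ; upperBound = λ x∈ y∈ → [,⟩-upperBound (inside x∈) (inside y∈) (proj₁ x∈)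
        }
        where
        inside : ∀ {x} → x ∈ [ s , t ⟩ → x ∈ J ∩ (↓ t)
        inside x∈ = [s,t⟩⊆J x∈ , proj₁ (proj₂ x∈)

      [,⟩-isSupremum : IsSupremum (J ∩ (↓ t)) t → IsSupremum [ s , t ⟩ t
      [,⟩-isSupremum sup = record
        { upper = λ x∈ → proj₁ (proj₂ x∈)
        ; least = λ bound → IsSupremum.least sup λ x∈ →
            let _ , z∈ , _ , x≤z = [,⟩-upperBound (s∈J , s≤t) x∈ ≤-refl
            in ≤-trans x≤z (bound z∈)
        }

module NestedIntervals {ℓ : Level} (P : Poset ℓ ℓ ℓ) (dcpo : DomainTheory.IsDCPO P) where

  open Poset P renaming (refl to ≤-refl; trans to ≤-trans)
  open DomainTheory P
  open IsDCPO dcpo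

  module _ (lo hi : ℕ → Carrier) (lo≤hi : ∀ n → lo n ≤ hi n)
    (lo-step : ∀ n → lo n ≤ lo (suc n)) (hi-step : ∀ n → hi (suc n) ≤ hi n) where

    private
      lo-mono′ : ∀ {m n} → m ≤′ n → lo m ≤ lo n
      lo-mono′ ≤′-refl       = ≤-refl
      lo-mono′ (≤′-step m≤n) = ≤-trans (lo-mono′ m≤n) (lo-step _)

      hi-anti′ : ∀ {m n} → m ≤′ n → hi n ≤ hi m
      hi-anti′ ≤′-refl       = ≤-refl
      hi-anti′ (≤′-step m≤n) = ≤-trans (hi-step _) (hi-anti′ m≤n)

    lo-mono : ∀ {m n} → m ℕ.≤ n → lo m ≤ lo n
    lo-mono m≤n = lo-mono′ (≤⇒≤′ m≤n)

    lo≤hi-any : ∀ m n → lo m ≤ hi n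
    lo≤hi-any m n = ≤-trans (lo-mono (m≤m⊔n m n))
      (≤-trans (lo≤hi (m ℕ.⊔ n)) (hi-anti′ (≤⇒≤′ (m≤n⊔m m n))))

    Range : Pred Carrier ℓ
    Range x = ∃ λ n → lo n ≡ x

    Range-isDirected : IsDirected Range
    Range-isDirected = record
      { nonempty   = lo 0 , 0 , refl
      ; upperBound = λ { (m , refl) (n , refl) →
          lo (m ℕ.⊔ n) , (m ℕ.⊔ n , refl) , lo-mono (m≤m⊔n m n) , lo-mono (m≤n⊔m m n) }
      }

    -- Every `hi n` bounds the whole chain of lower ends, hence also its supremum.
    intersection-nonempty : ∃ λ x → ∀ n → lo n ≤ x × x ≤ hi n
    intersection-nonempty = ⋁ Range Range-isDirected , λ n →
      IsSupremum.upper sup (n , refl) ,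
      IsSupremum.least sup λ { (m , refl) → lo≤hi-any m n }
      where sup = ⋁-isSupremum Range Range-isDirected

module Boundary {ℓ : Level} (em : ExcludedMiddle ℓ) (P : Poset ℓ ℓ ℓ)
  (dcpo : DomainTheory.IsDCPO P) where

  open Poset P renaming (refl to ≤-refl; trans to ≤-trans)
  open DomainTheory P
  open IsDCPO dcpo
  open MeetContinuity em P dcpo
  open Ideals P

  module _ (countable : Countable) (mc : IsMeetContinuous dcpo) (meets : HasBinaryMeets)
    {J : Pred Carrier ℓ} (ideal : IsIdeal J) where

    open IsIdeal ideal
    open Injection countable using (injective) renaming (to to code)

    -- The field `hi≤⋁J` is carried along so that meet-continuity applies to every upper end reached
    -- by shrinking.
    record Crossing : Set ℓ where
      field
        lo hi : Carrier
        lo∈J  : lo ∈ J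
        hi∉J  : hi ∉ J
        lo≤hi : lo ≤ hi
        hi≤⋁J : hi ≤ ⋁ J isDirected

    open Crossing

    Tight : Pred Crossing ℓ
    Tight I = [ lo I , hi I ⟩ ⊆ J

    Avoids : Crossing → Carrier → Set ℓ
    Avoids I x = ¬ (lo I ≤ x × x ≤ hi I)

    -- Stated for a set `X` to cover both an equivalence class of points and the possibly empty set
    -- of points with a given code.
    Shrinking : {a : Level} → Crossing → Pred Carrier a → Set (ℓ L.⊔ a)
    Shrinking I X = ∃ λ K → lo I ≤ lo K × hi K ≤ hi I × X ⊆ Avoids K

    -- Otherwise `x` would bound `J ∩ (↓ hi I)`, whose supremum is `hi I`, and `hi I` would fall
    -- into `J`.
    raise-lo : ∀ I {x} → x ∈ J → ∃ λ y → y ∈ J × lo I ≤ y × y ≤ hi I × ¬ y ≤ x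
    raise-lo I {x} x∈J = decidable-stable em λ none → hi∉J I (isLowerSet
      (IsSupremum.least (∩↓-isSupremum mc ideal (hi≤⋁J I)) λ y∈ →
        let z , (z∈J , z≤hi) , lo≤z , y≤z = ∩↓-upperBound ideal meets (lo∈J I , lo≤hi I) y∈
        in ≤-trans y≤z (decidable-stable em λ z≰x → none (z , z∈J , lo≤z , z≤hi , z≰x)))
      x∈J)

    module _ (noTight : ¬ ∃ Tight) where

      lower-hi : ∀ I → ∃ λ y → y ∉ J × lo I ≤ y × y < hi I
      lower-hi I = decidable-stable em λ none → noTight (I , λ {y} (lo≤y , y<hi) →
        decidable-stable em λ y∉J → none (y , y∉J , lo≤y , y<hi))

      shrink : ∀ I x → Shrinking I (x ≈_)
      shrink I x with em {x ∈ J} | em {lo I ≤ x × x ≤ hi I}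
      ... | yes x∈J | _
        with y , y∈J , lo≤y , y≤hi , y≰x ← raise-lo I x∈J
        = record { lo = y ; hi = hi I ; lo∈J = y∈J ; hi∉J = hi∉J I
                 ; lo≤hi = y≤hi ; hi≤⋁J = hi≤⋁J I }
        , lo≤y , ≤-refl
        , λ x≈z (y≤z , _) → y≰x (≤-trans y≤z (reflexive (Eq.sym x≈z)))
      ... | no x∉J | yes (lo≤x , x≤hi)
        -- The crossing is first cut off at `x` itself, so the new upper end lies strictly below
        -- `x`.
        with y , y∉J , lo≤y , y≤x , y≉x ← lower-hi
               record { lo = lo I ; hi = x ; lo∈J = lo∈J I ; hi∉J = x∉J
                      ; lo≤hi = lo≤x ; hi≤⋁J = ≤-trans x≤hi (hi≤⋁J I) }
        = record { lo = lo I ; hi = y ; lo∈J = lo∈J I ; hi∉J = y∉J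
                 ; lo≤hi = lo≤y ; hi≤⋁J = ≤-trans y≤x (≤-trans x≤hi (hi≤⋁J I)) }
        , ≤-refl , ≤-trans y≤x x≤hi
        , λ x≈z (_ , z≤y) → y≉x (antisym y≤x (≤-trans (reflexive x≈z) z≤y))
      ... | no _ | no x∉I
        = I , ≤-refl , ≤-refl
        , λ x≈z (lo≤z , z≤hi) → x∉I
            (≤-trans lo≤z (reflexive (Eq.sym x≈z)) , ≤-trans (reflexive x≈z) z≤hi)

      -- By injectivity, avoiding one point with code `n` avoids all of them; if `n` is not a code,
      -- the interval stays as it is.
      shrinkCode : ∀ I n → Shrinking I (λ x → code x ≡ n)
      shrinkCode I n with em {∃ λ x → Lift ℓ (code x ≡ n)}
      ... | yes (x , lift cx≡n)
        with K , lo≤ , hi≤ , avoids ← shrink I x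
        = K , lo≤ , hi≤ , λ cz≡n → avoids (injective (trans cx≡n (sym cz≡n)))
      ... | no none
        = I , ≤-refl , ≤-refl , λ cz≡n → contradiction (_ , lift cz≡n) none

      noCrossing : Crossing → ⊥
      -- Code `n` is removed in passing from stage `n` to stage `suc n`, so the common point `x` is
      -- already missing at stage `suc (code x)`.
      noCrossing I₀ = avoids (code x) refl (x∈ (suc (code x)))
        where
        open NestedIntervals P dcpo
        I : ℕ → Crossing
        I zero    = I₀
        I (suc n) = proj₁ (shrinkCode (I n) n)
        avoids : ∀ n {x} → code x ≡ n → Avoids (I (suc n)) x
        avoids n = proj₂ (proj₂ (proj₂ (shrinkCode (I n) n)))
        common = intersection-nonempty (λ n → lo (I n)) (λ n → hi (I n)) (λ n → lo≤hi (I n))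
          (λ n → proj₁ (proj₂ (shrinkCode (I n) n)))
          (λ n → proj₁ (proj₂ (proj₂ (shrinkCode (I n) n))))
        x  = proj₁ common
        x∈ = proj₂ common

    tightCrossing : Crossing → ∃ Tight
    tightCrossing I = decidable-stable em λ noTight → noCrossing noTight I

    fullCrossing : ¬ IsPrincipal J → Crossing
    fullCrossing nonprincipal = record
      { lo    = proj₁ nonempty
      ; hi    = ⋁ J isDirected
      ; lo∈J  = proj₂ nonempty
      -- An ideal containing its supremum is the principal ideal of that supremum.
      ; hi∉J  = λ ⋁J∈J → nonprincipal (_ , upper , λ y≤⋁J → isLowerSet y≤⋁J ⋁J∈J)
      ; lo≤hi = upper (proj₂ nonempty)
      ; hi≤⋁J = ≤-refl
      }
      where
      open IsDirected isDirected
      open IsSupremum (⋁-isSupremum J isDirected)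

proposition6p2 :
    {ℓ : Level} → ExcludedMiddle (L.suc ℓ) →
    (P : Poset ℓ ℓ ℓ) →
    let open Poset P using (_≤_)
        open DomainTheory P in
    (dcpo : IsDCPO) →
    let open IsDCPO dcpo using (⋁) in
    Countable → IsMeetContinuous dcpo → HasBinaryMeets →
    (J : Pred (Poset.Carrier P) ℓ) (ideal : IsIdeal J) → ¬ IsPrincipal J →
    ∃ λ s → ∃ λ t →
      s < t × t ≤ ⋁ J (IsIdeal.isDirected ideal) ×
      Σ (IsDirected [ s , t ⟩) λ dir →
        (⇓ [ s , t ⟩) ⊆ J × Poset._≈_ P (⋁ [ s , t ⟩ dir) t × t ∉ J
proposition6p2 em P dcpo countable mc meets J ideal nonprincipal
  = lo , hi , ∈∉⇒< ideal lo≤hi lo∈J hi∉J , hi≤⋁J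
  , dir
  , (λ (_ , a∈ , x≤a) → isLowerSet x≤a (tight a∈))
  -- `⋁-sup` comes from the dcpo structure and `sup` from meet-continuity; suprema of one set agree.
  , antisym (least ⋁-sup (upper sup)) (least sup (upper ⋁-sup))
  , hi∉J
  where
  open Poset P using (antisym)
  open DomainTheory P
  open IsIdeal ideal using (isLowerSet)
  open IsSupremum
  open Ideals P
  em₀ = lowerExcludedMiddle em
  open MeetContinuity em₀ P dcpo using (∩↓-isSupremum)
  open Boundary em₀ P dcpo
  tightExists = tightCrossing countable mc meets ideal
    (fullCrossing countable mc meets ideal nonprincipal)
  tight = proj₂ tightExists
  open Crossing (proj₁ tightExists)
  dir   = [,⟩-isDirected ideal meets lo∈J lo≤hi hi∉J tight
  sup   = [,⟩-isSupremum ideal meets lo∈J lo≤hi hi∉J tight (∩↓-isSupremum mc ideal hi≤⋁J)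
  ⋁-sup = IsDCPO.⋁-isSupremum dcpo [ lo , hi ⟩ dir
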